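{- Let $P\in N_1$ be a sum of $9$ monomials, not necessarily distinct (i.e. $P(1)=9$). Then $P$ has unique factorisation inside $N_1$: any two factorisations of $P$ into irreducible elements of $N_1$ coincide up to the order of the factors.
   Context: $N_1=\mathbb{Z}_{\ge0}[X]$ is the semiring of univariate polynomials with nonnegative integer coefficients. An element $Q\neq0,1$ of $N_1$ is irreducible if in every factorisation $Q=ST$ with $S,T\in N_1$ one of $S,T$ is $1$. -}

module Defs where

open import Data.List.Base using (List; []; _∷_; map; foldr)
open import Data.Nat.Base as ℕ using (ℕ; zero; suc)
open import Data.Product.Base using (_×_)
open import Data.Sum.Base using (_⊎_)
open import Level using (0ℓ)
open import Relation.Binary.Bundles using (Setoid)
open import Relation.Binary.PropositionalEquality using (_≡_; _→-setoid_)
open import Relation.Nullary.Negation using (¬_)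
import Relation.Binary.Construct.On as On
import Data.List.Relation.Binary.Permutation.Setoid as SetoidPermutation

-- Elements of ℤ≥0[X] as coefficient lists, constant term first.  Trailing
-- zeros are allowed, so equality of polynomials is _≈_, not _≡_.
N₁ : Set
N₁ = List ℕ

coeff : N₁ → ℕ → ℕ
coeff []      _       = 0
coeff (a ∷ _) zero    = a
coeff (_ ∷ p) (suc i) = coeff p i

infix 4 _≈_
_≈_ : N₁ → N₁ → Set
p ≈ q = ∀ i → coeff p i ≡ coeff q i

N₁-setoid : Setoid 0ℓ 0ℓ
N₁-setoid = record
  { Carrier       = N₁
  ; _≈_           = _≈_
  ; isEquivalence = Setoid.isEquivalence (On.setoid (ℕ →-setoid ℕ) coeff)
  }

0# : N₁
0# = []

1# : N₁
1# = 1 ∷ []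

infixl 6 _+_
_+_ : N₁ → N₁ → N₁
[]      + q       = q
(a ∷ p) + []      = a ∷ p
(a ∷ p) + (b ∷ q) = (a ℕ.+ b) ∷ (p + q)

-- (a + X p) q = a q + X (p q)
infixl 7 _*_
_*_ : N₁ → N₁ → N₁
[]      * q = []
(a ∷ p) * q = map (a ℕ.*_) q + (0 ∷ p * q)

eval : N₁ → ℕ → ℕ
eval []      x = 0
eval (a ∷ p) x = a ℕ.+ x ℕ.* eval p x

product : List N₁ → N₁
product = foldr _*_ 1#

Irreducible : N₁ → Set
Irreducible Q = ¬ (Q ≈ 0#) × ¬ (Q ≈ 1#) ×
                (∀ S T → Q ≈ S * T → S ≈ 1# ⊎ T ≈ 1#)

-- Permutation up to _≈_ of the entries.
open SetoidPermutation N₁-setoid public using (_↭_)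

{-# OPTIONS --safe #-}

-- The functionals p ↦ Σᵢ pᵢ f(i), for f : ℕ → ℕ, determine p and are
-- multiplicative in a convolution sense, so they replace ring arithmetic.
-- After the powers of X are split off, the factors have value 9, or 3 and 3,
-- at 1.  A factor of value 3 is 1 + Xᵃ + Xᵇ with a ≤ b, so the question is
-- whether the multiset sum {0,a,b} + {0,c,d} determines both summands.  The
-- maximum b + d and the total give a + c, and the second smallest element is
-- min(a,c); hence {a,c} is known.  The second largest element
-- max(a+d,b+c) then gives {a+d,b+c}, and the sum of squares excludes the
-- remaining mismatched combination.
module Submission where

open import Defs
open import Data.List.Base using (List; []; _∷_; _++_; map; replicate)
open import Data.List.Relation.Unary.All as All using (All; []; _∷_)
import Data.List.Relation.Binary.Permutation.Setoid as SetoidPermutation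
import Data.List.Relation.Binary.Permutation.Setoid.Properties as PermutationProperties
open import Data.Nat.Base as ℕ using (ℕ; zero; suc; _∸_; _⊓_; _⊔_; _≤_; s≤s; z≤n)
open import Data.Nat.Divisibility using (_∣_; _∣?_; divides; ∣⇒≤)
open import Data.Nat.Properties
open import Data.Nat.Tactic.RingSolver using (solve-∀)
open import Data.Product.Base using (∃; ∃₂; _×_; _,_; proj₁; proj₂)
open import Data.Sum.Base using (_⊎_; inj₁; inj₂; [_,_]′; swap)
open import Function.Base using (_∘_; const; id)
open import Relation.Binary.Bundles using (Setoid)
open import Relation.Binary.PropositionalEquality
  using (_≡_; refl; sym; trans; cong; cong₂; subst; module ≡-Reasoning)
open import Relation.Nullary.Decidable using (from-no)
open import Relation.Nullary.Negation using (¬_; contradiction)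

open Setoid N₁-setoid using () renaming (refl to ≈-refl)
open SetoidPermutation N₁-setoid using (↭-refl; ↭-sym; ↭-trans; ↭-prep)
open PermutationProperties N₁-setoid using (shift; ++⁺ˡ)

-- Moments

-- Linear in the polynomial, with `f` arbitrary so that truncated differences and squares can serve
-- as test functions. The choice `δ i` gives a coefficient, `const 1` the value at 1.
moment : (ℕ → ℕ) → N₁ → ℕ
moment f []      = 0
moment f (a ∷ p) = a ℕ.* f 0 ℕ.+ moment (f ∘ suc) p

moment-ext : ∀ {f g} → (∀ i → f i ≡ g i) → ∀ p → moment f p ≡ moment g p
moment-ext e []      = refl
moment-ext e (a ∷ p) = cong₂ ℕ._+_ (cong (a ℕ.*_) (e 0)) (moment-ext (e ∘ suc) p)

moment-≈0 : ∀ f p → p ≈ 0# → moment f p ≡ 0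
moment-≈0 f []      e = refl
moment-≈0 f (a ∷ p) e rewrite e 0 = moment-≈0 (f ∘ suc) p (e ∘ suc)

moment-resp-≈ : ∀ f p q → p ≈ q → moment f p ≡ moment f q
moment-resp-≈ f []      q       e = sym (moment-≈0 f q (sym ∘ e))
moment-resp-≈ f (a ∷ p) []      e = moment-≈0 f (a ∷ p) e
moment-resp-≈ f (a ∷ p) (b ∷ q) e =
  cong₂ ℕ._+_ (cong (ℕ._* f 0) (e 0)) (moment-resp-≈ (f ∘ suc) p q (e ∘ suc))

moment-+ : ∀ f p q → moment f (p + q) ≡ moment f p ℕ.+ moment f q
moment-+ f []      q       = refl
moment-+ f (a ∷ p) []      = sym (+-identityʳ _)
moment-+ f (a ∷ p) (b ∷ q) rewrite moment-+ (f ∘ suc) p q =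
  interchange a b (f 0) (moment (f ∘ suc) p) (moment (f ∘ suc) q)
  where
  interchange : ∀ a b x y z → (a ℕ.+ b) ℕ.* x ℕ.+ (y ℕ.+ z) ≡ a ℕ.* x ℕ.+ y ℕ.+ (b ℕ.* x ℕ.+ z)
  interchange = solve-∀

moment-scale : ∀ f a p → moment f (map (a ℕ.*_) p) ≡ a ℕ.* moment f p
moment-scale f a []      = sym (*-zeroʳ a)
moment-scale f a (b ∷ p) rewrite moment-scale (f ∘ suc) a p =
  factor a b (f 0) (moment (f ∘ suc) p)
  where
  factor : ∀ a b x y → a ℕ.* b ℕ.* x ℕ.+ a ℕ.* y ≡ a ℕ.* (b ℕ.* x ℕ.+ y)
  factor = solve-∀

-- Since `Xⁱ Xʲ = Xⁱ⁺ʲ`, the product contributes `f (i + j)` for each pair of monomials. In the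
-- recursion the shifted summand `0 ∷ p * q` turns `f` into `f ∘ suc`.
moment-* : ∀ f p q → moment f (p * q) ≡ moment (λ i → moment (λ j → f (i ℕ.+ j)) q) p
moment-* f []      q = refl
moment-* f (a ∷ p) q = trans (moment-+ f (map (a ℕ.*_) q) (0 ∷ p * q))
  (cong₂ ℕ._+_ (moment-scale f a q) (moment-* (f ∘ suc) p q))

moment-const : ∀ c p → moment (const c) p ≡ moment (const 1) p ℕ.* c
moment-const c []      = refl
moment-const c (a ∷ p) rewrite moment-const c p =
  factor a c (moment (const 1) p)
  where
  factor : ∀ a c x → a ℕ.* c ℕ.+ x ℕ.* c ≡ (a ℕ.* 1 ℕ.+ x) ℕ.* c
  factor = solve-∀

moment-zero : ∀ f → (∀ i → f i ≡ 0) → ∀ p → moment f p ≡ 0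
moment-zero f e p = trans (moment-ext e p) (trans (moment-const 0 p) (*-zeroʳ (moment (const 1) p)))

-- `product` ends every list of factors with `1#`; this removes that last factor.
moment-*1 : ∀ f p → moment f (p * 1#) ≡ moment f p
moment-*1 f p = trans (moment-* f p 1#) (moment-ext at-zero p)
  where
  at-zero : ∀ i → 1 ℕ.* f (i ℕ.+ 0) ℕ.+ 0 ≡ f i
  at-zero i rewrite +-identityʳ i = trans (+-identityʳ _) (+-identityʳ _)

-- Kronecker delta, by recursion on both indices so that `δ (suc i) ∘ suc` is `δ i` by computation.
δ : ℕ → ℕ → ℕ
δ zero    zero    = 1
δ zero    (suc j) = 0
δ (suc i) zero    = 0
δ (suc i) (suc j) = δ i j

moment-δ : ∀ p i → moment (δ i) p ≡ coeff p i
moment-δ []      i       = refl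
moment-δ (a ∷ p) zero
  rewrite moment-zero (δ 0 ∘ suc) (λ _ → refl) p | *-identityʳ a = +-identityʳ a
moment-δ (a ∷ p) (suc i) rewrite *-zeroʳ a = moment-δ p i

moments⇒≈ : ∀ p q → (∀ f → moment f p ≡ moment f q) → p ≈ q
moments⇒≈ p q e i = trans (sym (moment-δ p i)) (trans (e (δ i)) (moment-δ q i))

-- All terms are nonnegative, so the constant term's contribution cannot be cancelled by the others.
coeff₀*f₀≤moment : ∀ f p → coeff p 0 ℕ.* f 0 ≤ moment f p
coeff₀*f₀≤moment f []      = z≤n
coeff₀*f₀≤moment f (a ∷ p) = m≤m+n _ _

-- Values at 1

value : N₁ → ℕ
value = moment (const 1)

value≡eval : ∀ p → value p ≡ eval p 1
value≡eval []      = refl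
value≡eval (a ∷ p) = cong₂ ℕ._+_ (*-identityʳ a) (trans (value≡eval p) (sym (+-identityʳ _)))

value-* : ∀ p q → value (p * q) ≡ value p ℕ.* value q
value-* p q = trans (moment-* (const 1) p q) (moment-const (value q) p)

-- Natural numbers with sum zero are all zero. The list itself may still be a string of zeros.
value≡0⇒moment≡0 : ∀ p → value p ≡ 0 → ∀ f → moment f p ≡ 0
value≡0⇒moment≡0 []          e  f = refl
value≡0⇒moment≡0 (zero ∷ p)  e  f = value≡0⇒moment≡0 p e (f ∘ suc)

-- The first nonzero coefficient is lowered by one, which writes `p` as `Xⁱ + q`; moments express
-- this without adding lists.
split-monomial : ∀ p {n} → value p ≡ suc n →
  ∃₂ λ i q → value q ≡ n × (∀ f → moment f p ≡ f i ℕ.+ moment f q)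
split-monomial (zero ∷ p)  e with split-monomial p e
... | i , q , v , h = suc i , 0 ∷ q , v , λ f → h (f ∘ suc)
split-monomial (suc a ∷ p) e = 0 , a ∷ p , suc-injective e , λ f → +-assoc (f 0) (a ℕ.* f 0) _

split-constant : ∀ p {n} → ¬ (coeff p 0 ≡ 0) → value p ≡ suc n →
  ∃ λ q → value q ≡ n × (∀ f → moment f p ≡ f 0 ℕ.+ moment f q)
split-constant []          c e = contradiction refl c
split-constant (zero ∷ p)  c e = contradiction refl c
split-constant (suc a ∷ p) c e = a ∷ p , suc-injective e , λ f → +-assoc (f 0) (a ℕ.* f 0) _

value≡1⇒≈1 : ∀ p → ¬ (coeff p 0 ≡ 0) → value p ≡ 1 → p ≈ 1#
value≡1⇒≈1 p c e with split-constant p c e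
... | q , v , h = moments⇒≈ p 1# λ f → begin
    moment f p          ≡⟨ h f ⟩
    f 0 ℕ.+ moment f q  ≡⟨ cong (f 0 ℕ.+_) (value≡0⇒moment≡0 q v f) ⟩
    f 0 ℕ.+ 0           ≡⟨ cong (ℕ._+ 0) (sym (+-identityʳ (f 0))) ⟩
    moment f 1#         ∎
  where open ≡-Reasoning

-- Trinomials

-- The moment of `1 + Xᵃ + Xᵇ`, as a function of the exponents alone.
tri : ℕ → ℕ → (ℕ → ℕ) → ℕ
tri a b f = f 0 ℕ.+ (f a ℕ.+ f b)

tri-ext : ∀ a b {f g} → (∀ i → f i ≡ g i) → tri a b f ≡ tri a b g
tri-ext a b e = cong₂ ℕ._+_ (e 0) (cong₂ ℕ._+_ (e a) (e b))

-- Three monomials are peeled off, leaving a remainder of value 0. The nonzero constant term lets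
-- the first be 1; the other exponents may be zero or equal.
value≡3⇒trinomial : ∀ p → ¬ (coeff p 0 ≡ 0) → value p ≡ 3 →
  ∃₂ λ a b → a ≤ b × (∀ f → moment f p ≡ tri a b f)
value≡3⇒trinomial p c e with split-constant p c e
... | q , v , h with split-monomial q v
... | a , r , w , k with split-monomial r w
... | b , s , x , l = order (≤-total a b)
  where
  expand : ∀ f → moment f p ≡ tri a b f
  expand f rewrite h f | k f | l f | value≡0⇒moment≡0 s x f | +-identityʳ (f b) = refl
  order : a ≤ b ⊎ b ≤ a → ∃₂ λ a b → a ≤ b × (∀ f → moment f p ≡ tri a b f)
  order (inj₁ a≤b) = a , b , a≤b , expand
  order (inj₂ b≤a) = b , a , b≤a , λ f → trans (expand f) (cong (f 0 ℕ.+_) (+-comm (f a) (f b)))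

-- The sum of `f` over the nine elements of the multiset `{0,a,b} + {0,c,d}`, that is, the moment of
-- the product of two trinomials.
tri² : ℕ → ℕ → ℕ → ℕ → (ℕ → ℕ) → ℕ
tri² a b c d f = tri a b λ i → tri c d λ j → f (i ℕ.+ j)

tri²-comm : ∀ a b c d f → tri² a b c d f ≡ tri² c d a b f
tri²-comm a b c d f = trans
  (transpose (f 0) (f c) (f d) (f (a ℕ.+ 0)) (f (a ℕ.+ c)) (f (a ℕ.+ d))
             (f (b ℕ.+ 0)) (f (b ℕ.+ c)) (f (b ℕ.+ d)))
  (tri-ext c d λ i → tri-ext a b λ j → cong f (+-comm j i))
  where
  transpose : ∀ x₁ x₂ x₃ y₁ y₂ y₃ z₁ z₂ z₃ →
    x₁ ℕ.+ (x₂ ℕ.+ x₃) ℕ.+ (y₁ ℕ.+ (y₂ ℕ.+ y₃) ℕ.+ (z₁ ℕ.+ (z₂ ℕ.+ z₃))) ≡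
    x₁ ℕ.+ (y₁ ℕ.+ z₁) ℕ.+ (x₂ ℕ.+ (y₂ ℕ.+ z₂) ℕ.+ (x₃ ℕ.+ (y₃ ℕ.+ z₃)))
  transpose = solve-∀

moment-product₂ : ∀ {a b c d} p q → (∀ f → moment f p ≡ tri a b f) → (∀ f → moment f q ≡ tri c d f) →
  ∀ f → moment f (p * (q * 1#)) ≡ tri² a b c d f
moment-product₂ {a} {b} {c} {d} p q hp hq f = begin
  moment f (p * (q * 1#))                                ≡⟨ moment-* f p (q * 1#) ⟩
  moment (λ i → moment (λ j → f (i ℕ.+ j)) (q * 1#)) p  ≡⟨ moment-ext (λ i → trans (moment-*1 _ q) (hq _)) p ⟩
  moment (λ i → tri c d λ j → f (i ℕ.+ j)) p            ≡⟨ hp _ ⟩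
  tri² a b c d f                                         ∎
  where open ≡-Reasoning

-- Equality of the multisets `{0,a,b} + {0,c,d}` and `{0,a′,b′} + {0,c′,d′}`

SameSums : (a b c d a′ b′ c′ d′ : ℕ) → Set
SameSums a b c d a′ b′ c′ d′ = ∀ f → tri² a b c d f ≡ tri² a′ b′ c′ d′ f

SameSums-sym : ∀ {a b c d a′ b′ c′ d′} → SameSums a b c d a′ b′ c′ d′ → SameSums a′ b′ c′ d′ a b c d
SameSums-sym H f = sym (H f)

SameSums-swapˡ : ∀ {a b c d a′ b′ c′ d′} → SameSums a b c d a′ b′ c′ d′ → SameSums c d a b a′ b′ c′ d′
SameSums-swapˡ {a} {b} {c} {d} H f = trans (tri²-comm c d a b f) (H f)

SameSums-swapʳ : ∀ {a b c d a′ b′ c′ d′} → SameSums a b c d a′ b′ c′ d′ → SameSums a b c d c′ d′ a′ b′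
SameSums-swapʳ {a′ = a′} {b′} {c′} {d′} H f = trans (H f) (tri²-comm a′ b′ c′ d′ f)

m+n≡m⇒n≡0 : ∀ m {n} → m ℕ.+ n ≡ m → n ≡ 0
m+n≡m⇒n≡0 m {n} e = +-cancelˡ-≡ m n 0 (trans e (sym (+-identityʳ m)))

-- The grouping is that of `tri²` unfolded: `x₁` comes from the sum 0, while `x₂` and `y₁` come from
-- `c` and `a`, the candidates for the second smallest sum. If `x₁` alone gives the total, all other
-- terms vanish.
first-only : ∀ x₁ x₂ x₃ y₁ y₂ y₃ z →
  x₁ ℕ.+ (x₂ ℕ.+ x₃) ℕ.+ (y₁ ℕ.+ (y₂ ℕ.+ y₃) ℕ.+ z) ≡ x₁ → x₂ ≡ 0 × y₁ ≡ 0
first-only x₁ x₂ x₃ y₁ y₂ y₃ z e = m+n≡0⇒m≡0 x₂ rest≡0 , m+n≡0⇒m≡0 y₁ (m+n≡0⇒n≡0 x₂ rest≡0)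
  where
  rearrange : ∀ x₁ x₂ x₃ y₁ y₂ y₃ z →
    x₁ ℕ.+ (x₂ ℕ.+ (y₁ ℕ.+ (x₃ ℕ.+ (y₂ ℕ.+ (y₃ ℕ.+ z))))) ≡
    x₁ ℕ.+ (x₂ ℕ.+ x₃) ℕ.+ (y₁ ℕ.+ (y₂ ℕ.+ y₃) ℕ.+ z)
  rearrange = solve-∀
  rest≡0 : x₂ ℕ.+ (y₁ ℕ.+ (x₃ ℕ.+ (y₂ ℕ.+ (y₃ ℕ.+ z)))) ≡ 0
  rest≡0 = m+n≡m⇒n≡0 x₁ (trans (rearrange x₁ x₂ x₃ y₁ y₂ y₃ z) e)

-- The counterpart at the top: `z₃` comes from the sum `b + d`, while `y₃` and `z₂` come from
-- `a + d` and `b + c`, the candidates for the second largest sum.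
last-only : ∀ x y₁ y₂ y₃ z₁ z₂ z₃ →
  x ℕ.+ (y₁ ℕ.+ (y₂ ℕ.+ y₃) ℕ.+ (z₁ ℕ.+ (z₂ ℕ.+ z₃))) ≡ z₃ → y₃ ≡ 0 × z₂ ≡ 0
last-only x y₁ y₂ y₃ z₁ z₂ z₃ e = m+n≡0⇒m≡0 y₃ rest≡0 , m+n≡0⇒m≡0 z₂ (m+n≡0⇒n≡0 y₃ rest≡0)
  where
  rearrange : ∀ x y₁ y₂ y₃ z₁ z₂ z₃ →
    z₃ ℕ.+ (y₃ ℕ.+ (z₂ ℕ.+ (z₁ ℕ.+ (y₂ ℕ.+ (y₁ ℕ.+ x))))) ≡
    x ℕ.+ (y₁ ℕ.+ (y₂ ℕ.+ y₃) ℕ.+ (z₁ ℕ.+ (z₂ ℕ.+ z₃)))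
  rearrange = solve-∀
  rest≡0 : y₃ ℕ.+ (z₂ ℕ.+ (z₁ ℕ.+ (y₂ ℕ.+ (y₁ ℕ.+ x)))) ≡ 0
  rest≡0 = m+n≡m⇒n≡0 z₃ (trans (rearrange x y₁ y₂ y₃ z₁ z₂ z₃) e)

module _ {a b c d a′ b′ c′ d′} (H : SameSums a b c d a′ b′ c′ d′) where

  module _ (a′≤b′ : a′ ≤ b′) (c′≤d′ : c′ ≤ d′) where

    -- If t is the second smallest sum on the right, then Σ (t ∸ x) over the sums x
    -- is t there, contributed by x = 0; on the left x = 0 also contributes t.
    second-min-≤ : a′ ⊓ c′ ≤ a ⊓ c
    second-min-≤ = ⊓-glb t≤a t≤c
      where
      t = a′ ⊓ c′
      t≤a′ = m⊓n≤m a′ c′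
      t≤c′ = m⊓n≤n a′ c′
      t≤b′ = ≤-trans t≤a′ a′≤b′
      vanish : ∀ {x} → t ≤ x → t ∸ x ≡ 0
      vanish = m≤n⇒m∸n≡0
      right : tri² a′ b′ c′ d′ (t ∸_) ≡ t
      right rewrite vanish t≤c′ | vanish (≤-trans t≤c′ c′≤d′)
        | vanish (m≤n⇒m≤n+o 0 t≤a′) | vanish (m≤n⇒m≤n+o c′ t≤a′) | vanish (m≤n⇒m≤n+o d′ t≤a′)
        | vanish (m≤n⇒m≤n+o 0 t≤b′) | vanish (m≤n⇒m≤n+o c′ t≤b′) | vanish (m≤n⇒m≤n+o d′ t≤b′)
        | +-identityʳ t = +-identityʳ t
      zeros = first-only t (t ∸ c) (t ∸ d) (t ∸ (a ℕ.+ 0)) (t ∸ (a ℕ.+ c)) (t ∸ (a ℕ.+ d)) _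
                (trans (H (t ∸_)) right)
      t≤c = m∸n≡0⇒m≤n (proj₁ zeros)
      t≤a = subst (t ≤_) (+-identityʳ a) (m∸n≡0⇒m≤n (proj₂ zeros))

    -- With `t` the largest sum on the right, `Σ (x ∸ t)` is 0 there, hence also on the left. Each
    -- left term then vanishes, and the last one is that of `b + d`.
    max-≤ : b ℕ.+ d ≤ b′ ℕ.+ d′
    max-≤ = m∸n≡0⇒m≤n (m+n≡0⇒n≡0 (b ℕ.+ c ∸ t) (m+n≡0⇒n≡0 (b ℕ.+ 0 ∸ t)
              (m+n≡0⇒n≡0 (tri c d λ j → a ℕ.+ j ∸ t) (m+n≡0⇒n≡0 (tri c d λ j → j ∸ t)
                (trans (H (_∸ t)) right)))))
      where
      t = b′ ℕ.+ d′
      vanish : ∀ {x y} → x ≤ b′ → y ≤ d′ → x ℕ.+ y ∸ t ≡ 0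
      vanish p q = m≤n⇒m∸n≡0 (+-mono-≤ p q)
      right : tri² a′ b′ c′ d′ (_∸ t) ≡ 0
      right rewrite vanish z≤n (z≤n {d′}) | vanish z≤n c′≤d′ | vanish z≤n (≤-refl {d′})
        | vanish a′≤b′ (z≤n {d′}) | vanish a′≤b′ c′≤d′ | vanish a′≤b′ (≤-refl {d′})
        | vanish ≤-refl (z≤n {d′}) | vanish ≤-refl c′≤d′ | vanish ≤-refl (≤-refl {d′}) = refl

    -- Every right sum except `b′ + d′` is at most `t`, so `Σ (x ∸ t)` is `b′ + d′ ∸ t`. On the left
    -- `b + d` already contributes this amount, so `a + d` and `b + c` contribute nothing.
    second-max-≤ : b ℕ.+ d ≡ b′ ℕ.+ d′ → (a ℕ.+ d) ⊔ (b ℕ.+ c) ≤ (a′ ℕ.+ d′) ⊔ (b′ ℕ.+ c′)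
    second-max-≤ same-max = ⊔-lub (m∸n≡0⇒m≤n (proj₁ zeros)) (m∸n≡0⇒m≤n (proj₂ zeros))
      where
      t = (a′ ℕ.+ d′) ⊔ (b′ ℕ.+ c′)
      vanishˡ : ∀ {x y} → x ≤ a′ → y ≤ d′ → x ℕ.+ y ∸ t ≡ 0
      vanishˡ p q = m≤n⇒m∸n≡0 (≤-trans (+-mono-≤ p q) (m≤m⊔n _ _))
      vanishʳ : ∀ {y} → y ≤ c′ → b′ ℕ.+ y ∸ t ≡ 0
      vanishʳ q = m≤n⇒m∸n≡0 (≤-trans (+-monoʳ-≤ b′ q) (m≤n⊔m (a′ ℕ.+ d′) _))
      right : tri² a′ b′ c′ d′ (_∸ t) ≡ b′ ℕ.+ d′ ∸ t
      right rewrite vanishˡ z≤n (z≤n {d′}) | vanishˡ z≤n c′≤d′ | vanishˡ z≤n (≤-refl {d′})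
        | vanishˡ ≤-refl (z≤n {d′}) | vanishˡ ≤-refl c′≤d′ | vanishˡ ≤-refl (≤-refl {d′})
        | vanishʳ (z≤n {c′}) | vanishʳ (≤-refl {c′}) = refl
      zeros = last-only (tri c d λ j → j ∸ t)
                (a ℕ.+ 0 ∸ t) (a ℕ.+ c ∸ t) (a ℕ.+ d ∸ t) (b ℕ.+ 0 ∸ t) (b ℕ.+ c ∸ t) (b ℕ.+ d ∸ t)
                (trans (H (_∸ t)) (trans right (cong (_∸ t) (sym same-max))))

  -- Test with `f = id`: each of `a`, `b`, `c`, `d` occurs in three of the nine sums, whence the
  -- factor 3 to cancel.
  total-≡ : (a ℕ.+ c) ℕ.+ (b ℕ.+ d) ≡ (a′ ℕ.+ c′) ℕ.+ (b′ ℕ.+ d′)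
  total-≡ = *-cancelˡ-≡ _ _ 3 (trans (expand a b c d) (trans (H id) (sym (expand a′ b′ c′ d′))))
    where
    expand : ∀ a b c d → 3 ℕ.* ((a ℕ.+ c) ℕ.+ (b ℕ.+ d)) ≡
      (0 ℕ.+ (c ℕ.+ d)) ℕ.+ (((a ℕ.+ 0) ℕ.+ ((a ℕ.+ c) ℕ.+ (a ℕ.+ d))) ℕ.+ ((b ℕ.+ 0) ℕ.+ ((b ℕ.+ c) ℕ.+ (b ℕ.+ d))))
    expand = solve-∀

-- Meant for `x` the common minimum or maximum of two pairs, located in each by `⊓-sel` or `⊔-sel`.
-- Cancelling `x` from the equal totals matches the remaining elements.
sum-determines-other : ∀ {x m n m′ n′} → x ≡ m ⊎ x ≡ n → x ≡ m′ ⊎ x ≡ n′ → m ℕ.+ n ≡ m′ ℕ.+ n′ →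
  (m ≡ m′ × n ≡ n′) ⊎ (m ≡ n′ × n ≡ m′)
sum-determines-other {x} {n = n} {n′ = n′} (inj₁ refl) (inj₁ refl) s =
  inj₁ (refl , +-cancelˡ-≡ x n n′ s)
sum-determines-other {x} {n = n} {m′} (inj₁ refl) (inj₂ refl) s =
  inj₂ (refl , +-cancelˡ-≡ x n m′ (trans s (+-comm m′ x)))
sum-determines-other {x} {m} {n′ = n′} (inj₂ refl) (inj₁ refl) s =
  inj₂ (+-cancelˡ-≡ x m n′ (trans (+-comm x m) s) , refl)
sum-determines-other {x} {m} {m′ = m′} (inj₂ refl) (inj₂ refl) s =
  inj₁ (+-cancelʳ-≡ x m m′ s , refl)

SamePair : (a b c d a′ b′ c′ d′ : ℕ) → Set
SamePair a b c d a′ b′ c′ d′ =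
  (a ≡ a′ × b ≡ b′ × c ≡ c′ × d ≡ d′) ⊎ (a ≡ c′ × b ≡ d′ × c ≡ a′ × d ≡ b′)

-- With c = a + k, d = b′ + k and d′ = b + k the sums of squares differ by 2k(b′ − b).
crossed-≤ : ∀ {a b c d b′ d′} → a ≤ c → SameSums a b c d a b′ c d′ →
  a ℕ.+ d ≡ b′ ℕ.+ c → b ℕ.+ c ≡ a ℕ.+ d′ → SamePair a b c d a b′ c d′
crossed-≤ {a} {b} {_} {d} {b′} {d′} a≤c H e₁ e₂ with m≤n⇒∃[o]m+o≡n a≤c
... | k , refl = by-k k (+-cancelˡ-≡ a d (b′ ℕ.+ k) (trans e₁ (shuffle a b′ k)))
                        (+-cancelˡ-≡ a d′ (b ℕ.+ k) (trans (sym e₂) (shuffle a b k))) H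
  where
  shuffle : ∀ a b k → b ℕ.+ (a ℕ.+ k) ≡ a ℕ.+ (b ℕ.+ k)
  shuffle = solve-∀
  squares : ∀ a b b′ k →
    (0 ℕ.+ ((a ℕ.+ k) ℕ.* (a ℕ.+ k) ℕ.+ (b′ ℕ.+ k) ℕ.* (b′ ℕ.+ k))
    ℕ.+ ((a ℕ.+ 0) ℕ.* (a ℕ.+ 0) ℕ.+ ((a ℕ.+ (a ℕ.+ k)) ℕ.* (a ℕ.+ (a ℕ.+ k)) ℕ.+ (a ℕ.+ (b′ ℕ.+ k)) ℕ.* (a ℕ.+ (b′ ℕ.+ k)))
    ℕ.+ ((b ℕ.+ 0) ℕ.* (b ℕ.+ 0) ℕ.+ ((b ℕ.+ (a ℕ.+ k)) ℕ.* (b ℕ.+ (a ℕ.+ k)) ℕ.+ (b ℕ.+ (b′ ℕ.+ k)) ℕ.* (b ℕ.+ (b′ ℕ.+ k))))))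
    ℕ.+ 2 ℕ.* k ℕ.* b ≡
    (0 ℕ.+ ((a ℕ.+ k) ℕ.* (a ℕ.+ k) ℕ.+ (b ℕ.+ k) ℕ.* (b ℕ.+ k))
    ℕ.+ ((a ℕ.+ 0) ℕ.* (a ℕ.+ 0) ℕ.+ ((a ℕ.+ (a ℕ.+ k)) ℕ.* (a ℕ.+ (a ℕ.+ k)) ℕ.+ (a ℕ.+ (b ℕ.+ k)) ℕ.* (a ℕ.+ (b ℕ.+ k)))
    ℕ.+ ((b′ ℕ.+ 0) ℕ.* (b′ ℕ.+ 0) ℕ.+ ((b′ ℕ.+ (a ℕ.+ k)) ℕ.* (b′ ℕ.+ (a ℕ.+ k)) ℕ.+ (b′ ℕ.+ (b ℕ.+ k)) ℕ.* (b′ ℕ.+ (b ℕ.+ k))))))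
    ℕ.+ 2 ℕ.* k ℕ.* b′
  squares = solve-∀
  by-k : ∀ k {d d′} → d ≡ b′ ℕ.+ k → d′ ≡ b ℕ.+ k →
    SameSums a b (a ℕ.+ k) d a b′ (a ℕ.+ k) d′ → SamePair a b (a ℕ.+ k) d a b′ (a ℕ.+ k) d′
  -- For `k = 0` the low exponents `a` and `c` coincide, and the crossed matching is just the
  -- exchange of the two factors.
  by-k zero refl refl _ = inj₂ (sym (+-identityʳ a) , sym (+-identityʳ b) , +-identityʳ a , +-identityʳ b′)
  by-k (suc k) refl refl H with *-cancelˡ-≡ b b′ (2 ℕ.* suc k) (+-cancelˡ-≡ (tri² a b (a ℕ.+ suc k) (b′ ℕ.+ suc k) sq) _ _
      (trans (squares a b b′ (suc k)) (cong (ℕ._+ 2 ℕ.* suc k ℕ.* b′) (sym (H sq)))))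
    where sq = λ x → x ℕ.* x
  ... | refl = inj₁ (refl , refl , refl , refl)

SamePair-swap : ∀ {a b c d a′ b′ c′ d′} → SamePair a b c d a′ b′ c′ d′ → SamePair c d a b c′ d′ a′ b′
SamePair-swap (inj₁ (p , q , r , s)) = inj₁ (r , s , p , q)
SamePair-swap (inj₂ (p , q , r , s)) = inj₂ (r , s , p , q)

-- The maximum of `a + d` and `b + c` is the second largest sum, and their total is `a + c` plus the
-- largest sum. So this pair is known up to order: the straight matching gives the result by
-- cancellation, the crossed one through `crossed-≤`.
same-lows : ∀ {a b c d b′ d′} → a ≤ b → c ≤ d → a ≤ b′ → c ≤ d′ →
  SameSums a b c d a b′ c d′ → SamePair a b c d a b′ c d′
same-lows {a} {b} {c} {d} {b′} {d′} a≤b c≤d a≤b′ c≤d′ H =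
  [ straight , crossed ]′ (sum-determines-other (⊔-sel (a ℕ.+ d) (b ℕ.+ c))
    (subst (λ x → x ≡ a ℕ.+ d′ ⊎ x ≡ b′ ℕ.+ c) (sym same-second) (⊔-sel (a ℕ.+ d′) (b′ ℕ.+ c))) same-total)
  where
  same-max : b ℕ.+ d ≡ b′ ℕ.+ d′
  same-max = ≤-antisym (max-≤ H a≤b′ c≤d′) (max-≤ (SameSums-sym H) a≤b c≤d)
  same-second : (a ℕ.+ d) ⊔ (b ℕ.+ c) ≡ (a ℕ.+ d′) ⊔ (b′ ℕ.+ c)
  same-second = ≤-antisym (second-max-≤ H a≤b′ c≤d′ same-max)
                          (second-max-≤ (SameSums-sym H) a≤b c≤d (sym same-max))
  regroup : ∀ a b c d → (a ℕ.+ d) ℕ.+ (b ℕ.+ c) ≡ (a ℕ.+ c) ℕ.+ (b ℕ.+ d)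
  regroup = solve-∀
  same-total : (a ℕ.+ d) ℕ.+ (b ℕ.+ c) ≡ (a ℕ.+ d′) ℕ.+ (b′ ℕ.+ c)
  same-total = trans (regroup a b c d) (trans (cong (a ℕ.+ c ℕ.+_) same-max) (sym (regroup a b′ c d′)))
  straight : a ℕ.+ d ≡ a ℕ.+ d′ × b ℕ.+ c ≡ b′ ℕ.+ c → SamePair a b c d a b′ c d′
  straight (p , q) = inj₁ (refl , +-cancelʳ-≡ c b b′ q , refl , +-cancelˡ-≡ a d d′ p)
  crossed : a ℕ.+ d ≡ b′ ℕ.+ c × b ℕ.+ c ≡ a ℕ.+ d′ → SamePair a b c d a b′ c d′
  crossed (p , q) = [ (λ a≤c → crossed-≤ a≤c H p q)
                    -- Exchanging the factors on both sides reduces `c ≤ a` to the case before.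
                    , (λ c≤a → SamePair-swap (crossed-≤ c≤a (SameSums-swapˡ (SameSums-swapʳ H))
                                 (trans (+-comm c b) (trans q (+-comm a d′)))
                                 (trans (+-comm d a) (trans p (+-comm b′ c)))))
                    ]′ (≤-total a c)

SameSums⇒SamePair : ∀ {a b c d a′ b′ c′ d′} → a ≤ b → c ≤ d → a′ ≤ b′ → c′ ≤ d′ →
  SameSums a b c d a′ b′ c′ d′ → SamePair a b c d a′ b′ c′ d′
SameSums⇒SamePair {a} {b} {c} {d} {a′} {b′} {c′} {d′} a≤b c≤d a′≤b′ c′≤d′ H
  = [ (λ { (refl , refl) → same-lows a≤b c≤d a′≤b′ c′≤d′ H })
    -- Here `a = c′` and `c = a′`, so the right-hand factors are exchanged first and the resulting
    -- alternatives are exchanged back.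
    , (λ { (refl , refl) → swap (same-lows a≤b c≤d c′≤d′ a′≤b′ (SameSums-swapʳ H)) })
    ]′ (sum-determines-other (⊓-sel a c)
         (subst (λ x → x ≡ a′ ⊎ x ≡ c′) (sym same-min) (⊓-sel a′ c′)) same-low)
  where
  same-min : a ⊓ c ≡ a′ ⊓ c′
  same-min = ≤-antisym (second-min-≤ (SameSums-sym H) a≤b c≤d) (second-min-≤ H a′≤b′ c′≤d′)
  same-max : b ℕ.+ d ≡ b′ ℕ.+ d′
  same-max = ≤-antisym (max-≤ H a′≤b′ c′≤d′) (max-≤ (SameSums-sym H) a≤b c≤d)
  same-low : a ℕ.+ c ≡ a′ ℕ.+ c′
  same-low = +-cancelʳ-≡ (b ℕ.+ d) _ _
    (trans (total-≡ H) (cong (a′ ℕ.+ c′ ℕ.+_) (sym same-max)))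

-- Splitting off powers of X

X : N₁
X = 0 ∷ 1 ∷ []

-- A zero constant term exhibits `Q` as `X * p`. As `X` is not 1, irreducibility forces `p` to be 1.
≈X⊎coeff₀≢0 : ∀ Q → Irreducible Q → Q ≈ X ⊎ ¬ (coeff Q 0 ≡ 0)
≈X⊎coeff₀≢0 []        (Q≉0 , _)         = contradiction (λ _ → refl) Q≉0
≈X⊎coeff₀≢0 (suc a ∷ p) _                 = inj₂ λ ()
≈X⊎coeff₀≢0 (zero ∷ p)  (_ , _ , trivial) = inj₁ ([ X≉1 , p≈1⇒≈X ]′ (trivial X p Q≈X*p))
  where
  Q≈X*p : 0 ∷ p ≈ X * p
  Q≈X*p = moments⇒≈ (0 ∷ p) (X * p) λ f →
    sym (trans (moment-* f X p) (trans (+-identityʳ _) (+-identityʳ _)))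
  X≉1 : X ≈ 1# → 0 ∷ p ≈ X
  X≉1 e with () ← e 0
  p≈1⇒≈X : p ≈ 1# → 0 ∷ p ≈ X
  p≈1⇒≈X e zero    = refl
  p≈1⇒≈X e (suc i) = e i

coeff₀-* : ∀ p q → coeff (p * q) 0 ≡ coeff p 0 ℕ.* coeff q 0
coeff₀-* []      q       = refl
coeff₀-* (a ∷ p) []      = sym (*-zeroʳ a)
coeff₀-* (a ∷ p) (b ∷ q) = +-identityʳ _

coeff₀-product≢0 : ∀ {Qs} → All (λ Q → ¬ (coeff Q 0 ≡ 0)) Qs → ¬ (coeff (product Qs) 0 ≡ 0)
coeff₀-product≢0 [] ()
coeff₀-product≢0 {Q ∷ Qs} (Q₀≢0 ∷ Qs₀≢0) e =
  [ Q₀≢0 , coeff₀-product≢0 Qs₀≢0 ]′ (m*n≡0⇒m≡0∨n≡0 _ (trans (sym (coeff₀-* Q (product Qs))) e))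

IrreducibleNonX : N₁ → Set
IrreducibleNonX Q = Irreducible Q × ¬ (coeff Q 0 ≡ 0)

-- The last component says that `product Qs` is `Xᵏ` times `product Ss`: multiplication by `Xᵏ`
-- shifts the argument of the test function by `k`.
split-X : ∀ {Qs} → All Irreducible Qs → ∃₂ λ k Ss →
  Qs ↭ replicate k X ++ Ss × All IrreducibleNonX Ss ×
  (∀ f → moment f (product Qs) ≡ moment (λ j → f (k ℕ.+ j)) (product Ss))
split-X [] = 0 , [] , ↭-refl , [] , λ f → refl
split-X {Q ∷ Qs} (irr ∷ irrs) with split-X irrs | ≈X⊎coeff₀≢0 Q irr
... | k , Ss , perm , irrSs , h | inj₁ Q≈X = suc k , Ss , SetoidPermutation.prep Q≈X perm , irrSs , shifted
  where
  shifted : ∀ f → moment f (Q * product Qs) ≡ moment (λ j → f (suc k ℕ.+ j)) (product Ss)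
  shifted f = trans (moment-* f Q (product Qs)) (trans (moment-resp-≈ _ Q X Q≈X)
    (trans (trans (+-identityʳ _) (+-identityʳ _)) (h (f ∘ suc))))
... | k , Ss , perm , irrSs , h | inj₂ Q₀≢0 =
  k , Q ∷ Ss , ↭-trans (↭-prep Q perm) (↭-sym (shift (≈-refl {Q}) (replicate k X) Ss)) ,
  (irr , Q₀≢0) ∷ irrSs , λ f → begin
    moment f (Q * product Qs)
      ≡⟨ moment-* f Q (product Qs) ⟩
    moment (λ i → moment (λ j → f (i ℕ.+ j)) (product Qs)) Q
      ≡⟨ moment-ext (λ i → trans (h _) (moment-ext (λ j → cong f (exchange i k j)) (product Ss))) Q ⟩
    moment (λ i → moment (λ j → f (k ℕ.+ (i ℕ.+ j))) (product Ss)) Q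
      ≡⟨ sym (moment-* _ Q (product Ss)) ⟩
    moment (λ j → f (k ℕ.+ j)) (product (Q ∷ Ss)) ∎
  where
  open ≡-Reasoning
  exchange : ∀ i k j → i ℕ.+ (k ℕ.+ j) ≡ k ℕ.+ (i ℕ.+ j)
  exchange = solve-∀

-- The hypothesis reads `Xᵏ p = Xˡ q`. The test function `l ∸_` kills every exponent from `l` on, so
-- the right side is 0, while the left is at least `p₀ (l ∸ k)` with `p₀` nonzero.
order-≤ : ∀ k l p q → ¬ (coeff p 0 ≡ 0) →
  (∀ f → moment (λ j → f (k ℕ.+ j)) p ≡ moment (λ j → f (l ℕ.+ j)) q) → l ≤ k
order-≤ k l p q p₀≢0 h = subst (l ≤_) (+-identityʳ k) (m∸n≡0⇒m≤n (
  [ (λ p₀≡0 → contradiction p₀≡0 p₀≢0) , id ]′ (m*n≡0⇒m≡0∨n≡0 (coeff p 0) (n≤0⇒n≡0 p₀*≤0))))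
  where
  p₀*≤0 : coeff p 0 ℕ.* (l ∸ (k ℕ.+ 0)) ≤ 0
  p₀*≤0 = subst (coeff p 0 ℕ.* (l ∸ (k ℕ.+ 0)) ≤_)
    (trans (h (l ∸_)) (moment-zero _ (λ j → m≤n⇒m∸n≡0 (m≤m+n l j)) q))
    (coeff₀*f₀≤moment _ p)

-- Factorisations of value 9

value≢1 : ∀ Q → IrreducibleNonX Q → ¬ (value Q ≡ 1)
value≢1 Q ((_ , Q≉1 , _) , Q₀≢0) v = Q≉1 (value≡1⇒≈1 Q Q₀≢0 v)

value-product≡1 : ∀ {Qs} → All IrreducibleNonX Qs → value (product Qs) ≡ 1 → Qs ≡ []
value-product≡1 []         _ = refl
value-product≡1 {Q ∷ Qs} (irr ∷ _) v = contradiction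
  (m*n≡1⇒m≡1 (value Q) (value (product Qs)) (trans (sym (value-* Q (product Qs))) v)) (value≢1 Q irr)

divisors-of-3 : ∀ m n → m ℕ.* n ≡ 3 → m ≡ 1 ⊎ (m ≡ 3 × n ≡ 1)
divisors-of-3 m n e with ∣⇒≤ (divides n (trans (sym e) (*-comm m n)))
divisors-of-3 0 n () | _
divisors-of-3 1 n e | _ = inj₁ refl
divisors-of-3 2 n e | _ = contradiction (divides n (trans (sym e) (*-comm 2 n))) (from-no (2 ∣? 3))
divisors-of-3 3 n e | _ = inj₂ (refl , *-cancelˡ-≡ n 1 3 e)
divisors-of-3 (suc (suc (suc (suc _)))) n e | s≤s (s≤s (s≤s ()))

divisors-of-9 : ∀ m n → m ℕ.* n ≡ 9 → m ≡ 1 ⊎ (m ≡ 9 × n ≡ 1) ⊎ (m ≡ 3 × n ≡ 3)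
divisors-of-9 m n e = by-cases m m∣9 (∣⇒≤ m∣9) e
  where
  m∣9 : m ∣ 9
  m∣9 = divides n (trans (sym e) (*-comm m n))
  by-cases : ∀ m → m ∣ 9 → m ≤ 9 → m ℕ.* n ≡ 9 → m ≡ 1 ⊎ (m ≡ 9 × n ≡ 1) ⊎ (m ≡ 3 × n ≡ 3)
  by-cases 0 d _ ()
  by-cases 1 d _ e = inj₁ refl
  by-cases 2 d _ e = contradiction d (from-no (2 ∣? 9))
  by-cases 3 d _ e = inj₂ (inj₂ (refl , *-cancelˡ-≡ n 3 3 e))
  by-cases 4 d _ e = contradiction d (from-no (4 ∣? 9))
  by-cases 5 d _ e = contradiction d (from-no (5 ∣? 9))
  by-cases 6 d _ e = contradiction d (from-no (6 ∣? 9))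
  by-cases 7 d _ e = contradiction d (from-no (7 ∣? 9))
  by-cases 8 d _ e = contradiction d (from-no (8 ∣? 9))
  by-cases 9 d _ e = inj₂ (inj₁ (refl , *-cancelˡ-≡ n 1 9 e))
  by-cases (suc (suc (suc (suc (suc (suc (suc (suc (suc (suc _)))))))))) d
    (s≤s (s≤s (s≤s (s≤s (s≤s (s≤s (s≤s (s≤s (s≤s ()))))))))) e

-- The only possible shapes: no factor has value 1, and `3 · 3` is the only splitting of 9 into
-- factors other than 1.
data Factors : List N₁ → Set where
  one : ∀ {Q}   → IrreducibleNonX Q → Factors (Q ∷ [])
  two : ∀ {Q R} → IrreducibleNonX Q → IrreducibleNonX R →
        value Q ≡ 3 → value R ≡ 3 → Factors (Q ∷ R ∷ [])

value-product≡9 : ∀ {Qs} → All IrreducibleNonX Qs → value (product Qs) ≡ 9 → Factors Qs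
value-product≡9 {Q ∷ Qs} (irr ∷ irrs) v
  with divisors-of-9 (value Q) (value (product Qs)) (trans (sym (value-* Q (product Qs))) v)
... | inj₁ u = contradiction u (value≢1 Q irr)
... | inj₂ (inj₁ (_ , w)) with refl ← value-product≡1 irrs w = one irr
-- The remaining product has value 3, so it is not empty, and by primality of 3 its first factor
-- takes all of that value.
value-product≡9 {Q ∷ R ∷ Rs} (irr ∷ irr′ ∷ irrs) v | inj₂ (inj₂ (u , w))
  with divisors-of-3 (value R) (value (product Rs)) (trans (sym (value-* R (product Rs))) w)
... | inj₁ x = contradiction x (value≢1 R irr′)
... | inj₂ (x , y) with refl ← value-product≡1 irrs y = two irr irr′ u x

-- Otherwise `Q` would be `R * S`, and irreducibility of `Q` would make `R` or `S` equal to 1.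
irreducible≢product : ∀ Q R S → IrreducibleNonX Q → IrreducibleNonX R → IrreducibleNonX S →
  ¬ (∀ f → moment f (Q * 1#) ≡ moment f (R * (S * 1#)))
irreducible≢product Q R S ((_ , _ , trivial) , _) ((_ , R≉1 , _) , _) ((_ , S≉1 , _) , _) h =
  [ R≉1 , S≉1 ]′ (trivial R S (moments⇒≈ Q (R * S) λ f → begin
    moment f Q                                              ≡⟨ sym (moment-*1 f Q) ⟩
    moment f (Q * 1#)                                       ≡⟨ h f ⟩
    moment f (R * (S * 1#))                                 ≡⟨ moment-* f R (S * 1#) ⟩
    moment (λ i → moment (λ j → f (i ℕ.+ j)) (S * 1#)) R   ≡⟨ moment-ext (λ i → moment-*1 _ S) R ⟩
    moment (λ i → moment (λ j → f (i ℕ.+ j)) S) R          ≡⟨ sym (moment-* f R S) ⟩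
    moment f (R * S)                                        ∎))
  where open ≡-Reasoning

Factors-unique : ∀ {Qs Rs} → Factors Qs → Factors Rs →
  (∀ f → moment f (product Qs) ≡ moment f (product Rs)) → Qs ↭ Rs
Factors-unique (one {Q} _) (one {R} _) h = SetoidPermutation.prep
  (moments⇒≈ Q R λ f → trans (sym (moment-*1 f Q)) (trans (h f) (moment-*1 f R))) ↭-refl
Factors-unique (one {Q} irr) (two {R} {S} irr₁ irr₂ _ _) h =
  contradiction h (irreducible≢product Q R S irr irr₁ irr₂)
Factors-unique (two {R} {S} irr₁ irr₂ _ _) (one {Q} irr) h =
  contradiction (sym ∘ h) (irreducible≢product Q R S irr irr₁ irr₂)
Factors-unique (two {Q} {Q′} (_ , c₁) (_ , c₂) v₁ v₂) (two {R} {R′} (_ , c₃) (_ , c₄) v₃ v₄) h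
  with value≡3⇒trinomial Q c₁ v₁ | value≡3⇒trinomial Q′ c₂ v₂
     | value≡3⇒trinomial R c₃ v₃ | value≡3⇒trinomial R′ c₄ v₄
... | a , b , a≤b , hQ | c , d , c≤d , hQ′ | a′ , b′ , a′≤b′ , hR | c′ , d′ , c′≤d′ , hR′
  with SameSums⇒SamePair a≤b c≤d a′≤b′ c′≤d′ (λ f →
    trans (sym (moment-product₂ Q Q′ hQ hQ′ f)) (trans (h f) (moment-product₂ R R′ hR hR′ f)))
... | inj₁ (refl , refl , refl , refl) = SetoidPermutation.prep (moments⇒≈ Q R λ f → trans (hQ f) (sym (hR f)))
  (SetoidPermutation.prep (moments⇒≈ Q′ R′ λ f → trans (hQ′ f) (sym (hR′ f))) ↭-refl)
... | inj₂ (refl , refl , refl , refl) = SetoidPermutation.swap (moments⇒≈ Q R′ λ f → trans (hQ f) (sym (hR′ f)))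
  (moments⇒≈ Q′ R λ f → trans (hQ′ f) (sym (hR f))) ↭-refl

mainTheorem11 : (P : N₁) → eval P 1 ≡ 9 →
    (Qs Rs : List N₁) →
    All Irreducible Qs → P ≈ product Qs →
    All Irreducible Rs → P ≈ product Rs →
    Qs ↭ Rs
mainTheorem11 P P1≡9 Qs Rs irrQs P≈Qs irrRs P≈Rs with split-X irrQs | split-X irrRs
... | k , Ss , permQs , irrSs , hQs | l , Ts , permRs , irrTs , hRs =
  ↭-trans permQs (↭-trans (same-power (≤-antisym k≤l l≤k)) (↭-sym permRs))
  where
  nonzero : ∀ {Us} → All IrreducibleNonX Us → ¬ (coeff (product Us) 0 ≡ 0)
  nonzero irrs = coeff₀-product≢0 (All.map proj₂ irrs)
  agree : ∀ f → moment (λ j → f (k ℕ.+ j)) (product Ss) ≡ moment (λ j → f (l ℕ.+ j)) (product Ts)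
  agree f = trans (sym (hQs f)) (trans (sym (moment-resp-≈ f P (product Qs) P≈Qs))
    (trans (moment-resp-≈ f P (product Rs) P≈Rs) (hRs f)))
  k≤l : k ≤ l
  k≤l = order-≤ l k (product Ts) (product Ss) (nonzero irrTs) (sym ∘ agree)
  l≤k : l ≤ k
  l≤k = order-≤ k l (product Ss) (product Ts) (nonzero irrSs) agree
  P-value : value P ≡ 9
  P-value = trans (value≡eval P) P1≡9
  value-Ss : value (product Ss) ≡ 9
  -- The constant test function is unaffected by the shift by `k`, since powers of `X` have value 1.
  value-Ss = trans (sym (hQs (const 1))) (trans (sym (moment-resp-≈ (const 1) P (product Qs) P≈Qs)) P-value)
  value-Ts : value (product Ts) ≡ 9
  value-Ts = trans (sym (hRs (const 1))) (trans (sym (moment-resp-≈ (const 1) P (product Rs) P≈Rs)) P-value)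
  cancel : ∀ m → (∀ f → moment (λ j → f (m ℕ.+ j)) (product Ss) ≡ moment (λ j → f (m ℕ.+ j)) (product Ts)) →
    ∀ f → moment f (product Ss) ≡ moment f (product Ts)
  -- The test function `i ↦ f (i ∸ m)` undoes the shift by `m`, which amounts to cancelling `Xᵐ`.
  cancel m h f = trans (moment-ext (λ j → cong f (sym (m+n∸m≡n m j))) (product Ss))
    (trans (h (λ i → f (i ∸ m))) (moment-ext (λ j → cong f (m+n∸m≡n m j)) (product Ts)))
  same-power : k ≡ l → replicate k X ++ Ss ↭ replicate l X ++ Ts
  same-power refl = ++⁺ˡ (replicate k X)
    (Factors-unique (value-product≡9 irrSs value-Ss) (value-product≡9 irrTs value-Ts) (cancel k agree))
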